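{- There is an absolute constant $C>0$ such that for every $n\ge 2$ and every binary matrix $M \in \{0,1\}^{n \times n}$ of twin-width $d$, both the row-Hamming-coherence and the column-Hamming-coherence of $M$ satisfy $\mathscr{H}^r(M),\, \mathscr{H}^c(M) \le 2^{2^{C(d+1)}} \cdot n \log n$, i.e. $\mathscr{H}^r(M), \mathscr{H}^c(M) \in 2^{2^{\mathcal{O}(d)}}\cdot n\log n$.
   Context: The Hamming distance of $u,v\in\{0,1\}^n$ is $d(u,v)=\sum_{i=1}^n |u_i-v_i|$. Let $r^{(1)},\dots,r^{(n)}$ be the rows of $M$. For a permutation $\pi$ of $\{1,\dots,n\}$, the row-Hamming-sum is $\mathscr{H}^r_\pi(M)=\sum_{i=1}^{n-1} d(r^{(\pi(i))}, r^{(\pi(i+1))})$, and the row-Hamming-coherence is $\mathscr{H}^r(M)=\min_\pi \mathscr{H}^r_\pi(M)$. The column-Hamming-sum and column-Hamming-coherence $\mathscr{H}^c(M)$ are defined analogously using the columns. A merge sequence for a binary matrix is a sequence of merges of two neighboring rows or two neighboring columns of the current matrix until a single entry remains; merging two columns gives a column whose $i$-th entry is $0$ (resp. $1$) if both merged entries are $0$ (resp. $1$), and the error symbol $\bot$ otherwise (including when one is $\bot$); row merges are analogous. $M$ is $d$-twin-ordered if it has a merge sequence in which every row and column of every intermediate matrix contains at most $d$ symbols $\bot$. The twin-width of $M$ is the least $d$ such that some reordering of its rows and of its columns is $d$-twin-ordered. -}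

module Defs where

open import Data.Bool using (Bool; true; false; if_then_else_)
open import Data.Nat using (ℕ; zero; suc; _+_; _*_; _^_; _≤_; _<_; _<ᵇ_; _≡ᵇ_)
open import Data.Fin using (Fin; zero; suc; toℕ; inject₁)
open import Data.Fin.Permutation using (Permutation′; _⟨$⟩ʳ_)
open import Data.Product using (Σ; _×_; ∃)
open import Relation.Nullary using (¬_)
open import Function using (_∘_)
open import Relation.Binary.PropositionalEquality using (_≡_)

BinMat : ℕ → Set
BinMat n = Fin n → Fin n → Bool

transpose : ∀ {n} → BinMat n → BinMat n
transpose M i j = M j i

diff : Bool → Bool → ℕ
diff true  true  = 0
diff false false = 0
diff _     _     = 1

hamming : ∀ {k} → (Fin k → Bool) → (Fin k → Bool) → ℕ
hamming {zero}  u v = 0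
hamming {suc k} u v = diff (u zero) (v zero) + hamming (u ∘ suc) (v ∘ suc)

hamPath : ∀ {m k} → (Fin m → Fin k → Bool) → ℕ
hamPath {zero}        f = 0
hamPath {suc zero}    f = 0
hamPath {suc (suc m)} f = hamming (f zero) (f (suc zero)) + hamPath (f ∘ suc)

rowHammingSum : ∀ {n} → BinMat n → Permutation′ n → ℕ
rowHammingSum M π = hamPath (λ i → M (π ⟨$⟩ʳ i))

IsRowHammingCoherence : ∀ {n} → BinMat n → ℕ → Set
IsRowHammingCoherence M h =
  (∃ λ π → rowHammingSum M π ≡ h) × (∀ π → h ≤ rowHammingSum M π)

IsColHammingCoherence : ∀ {n} → BinMat n → ℕ → Set
IsColHammingCoherence M h = IsRowHammingCoherence (transpose M) h

data Entry : Set where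
  e0 e1 err : Entry

toEntry : Bool → Entry
toEntry false = e0
toEntry true  = e1

mergeE : Entry → Entry → Entry
mergeE e0 e0 = e0
mergeE e1 e1 = e1
mergeE _  _  = err

Mat : ℕ → ℕ → Set
Mat r c = Fin r → Fin c → Entry

mergeRows : ∀ {r c} → Mat (suc (suc r)) c → Fin (suc r) → Mat (suc r) c
mergeRows A i k j =
  if toℕ k <ᵇ toℕ i then A (inject₁ k) j
  else if toℕ k ≡ᵇ toℕ i then mergeE (A (inject₁ k) j) (A (suc k) j)
  else A (suc k) j

mergeCols : ∀ {r c} → Mat r (suc (suc c)) → Fin (suc c) → Mat r (suc c)
mergeCols A i k j =
  if toℕ j <ᵇ toℕ i then A k (inject₁ j)
  else if toℕ j ≡ᵇ toℕ i then mergeE (A k (inject₁ j)) (A k (suc j))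
  else A k (suc j)

isErr : Entry → ℕ
isErr err = 1
isErr _   = 0

countErr : ∀ {k} → (Fin k → Entry) → ℕ
countErr {zero}  f = 0
countErr {suc k} f = isErr (f zero) + countErr (f ∘ suc)

ErrBounded : ∀ {r c} → ℕ → Mat r c → Set
ErrBounded d A = (∀ i → countErr (A i) ≤ d) × (∀ j → countErr (λ i → A i j) ≤ d)

data MergeSeq (d : ℕ) : ∀ {r c} → Mat r c → Set where
  single : (A : Mat 1 1) → ErrBounded d A → MergeSeq d A
  rowMerge : ∀ {r c} (A : Mat (suc (suc r)) c) (i : Fin (suc r)) →
             ErrBounded d A → MergeSeq d (mergeRows A i) → MergeSeq d A
  colMerge : ∀ {r c} (A : Mat r (suc (suc c))) (i : Fin (suc c)) →
             ErrBounded d A → MergeSeq d (mergeCols A i) → MergeSeq d A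

TwinOrdered : ∀ {n} → ℕ → BinMat n → Set
TwinOrdered d M = MergeSeq d (λ i j → toEntry (M i j))

reorder : ∀ {n} → BinMat n → Permutation′ n → Permutation′ n → BinMat n
reorder M σ τ i j = M (σ ⟨$⟩ʳ i) (τ ⟨$⟩ʳ j)

TwinWidth≤ : ∀ {n} → BinMat n → ℕ → Set
TwinWidth≤ M d = ∃ λ σ → ∃ λ τ → TwinOrdered d (reorder M σ τ)

HasTwinWidth : ∀ {n} → BinMat n → ℕ → Set
HasTwinWidth M d = TwinWidth≤ M d × (∀ d′ → d′ < d → ¬ TwinWidth≤ M d′)

{-# OPTIONS --safe #-}
-- Follow the merge sequence while keeping one representative column per column
-- part, weighted by the size of the part. When two parts are merged, the lighter
-- representative b is dropped and its weight moves to the heavier one a.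
-- Conversely, a path through all row vectors occurring after the merge becomes a
-- path for the situation before it: extend each vector by b = a, and insert the
-- variant with b ≠ a where it is needed. Such a variant lies in a row part with
-- an error at the merged column; there are at most d of these, each meeting at
-- most 2 ^ d vectors, and every insertion costs at most twice the weight of b.
-- Summing the lighter weights over all column merges gives at most n log n, so
-- the total is singly exponential in d times n log n.
module Submission where

open import Defs
open import Data.Bool using (Bool; true; false; not)
open import Data.Bool.Properties using () renaming (_≟_ to _≟ᵇ_)
open import Data.Empty using (⊥-elim)
open import Data.Fin using (Fin; zero; suc; inject₁; punchIn; cast)
open import Data.Fin.Permutation using (Permutation′; _⟨$⟩ʳ_; _⟨$⟩ˡ_; inverseʳ; cast-id; _∘ₚ_)
open import Data.Fin.Properties using (cast-involutive)
open import Data.List using (List; []; _∷_; _++_; length; filter; lookup; map; allFin; cartesianProductWith)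
open import Data.List.Membership.Propositional using (_∈_)
open import Data.List.Membership.Propositional.Properties using (∈-++⁺ˡ; ∈-++⁺ʳ; ∈-++⁻; ∈-∃++; ∈-filter⁻; ∈-cartesianProductWith⁺)
open import Data.List.Properties using (length-++; length-map; length-tabulate; lookup-tabulate)
open import Data.List.Relation.Binary.Permutation.Propositional using (_↭_; ↭-refl; ↭-trans; prep; ↭⇒↭ₛ)
open import Data.List.Relation.Binary.Permutation.Propositional.Properties using (++⁺ˡ; shift; ↭-length)
open import Data.List.Relation.Binary.Permutation.Homogeneous using (onIndices)
open import Data.List.Relation.Binary.Permutation.Setoid.Properties using (onIndices-lookup)
open import Data.List.Relation.Unary.All as All using (All)
open import Data.List.Relation.Unary.All.Properties using (all-filter)
open import Data.List.Relation.Unary.AllPairs using ([]; _∷_)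
open import Data.List.Relation.Unary.Any using (here; there)
open import Data.List.Relation.Unary.Unique.Propositional using (Unique)
open import Data.List.Relation.Unary.Unique.Propositional.Properties using (filter⁺)
open import Data.Nat using (ℕ; zero; suc; _+_; _*_; _^_; _≤_; _<_; z≤n; s≤s)
open import Data.Nat.Logarithm using (⌊log₂_⌋; ⌊log₂⌋-mono-≤; ⌊log₂[2*b]⌋≡1+⌊log₂b⌋)
open import Data.Nat.Properties
open import Data.Nat.Tactic.RingSolver using (solve-∀)
open import Algebra.Properties.CommutativeMonoid.Sum +-0-commutativeMonoid using (sum; sum-permute)
open import Data.Product using (Σ; _×_; _,_; ∃; proj₁; proj₂)
open import Data.Sum using (inj₁; inj₂)
open import Data.Vec as Vec using (Vec; []; _∷_; insertAt; removeAt; updateAt; replicate)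
open import Data.Vec.Properties using (insertAt-lookup; removeAt-insertAt; insertAt-removeAt; ≡-dec; lookup∘tabulate)
open import Function using (_∘_; id)
open import Level using (0ℓ)
open import Relation.Binary.Definitions using (DecidableEquality)
open import Relation.Binary.PropositionalEquality using (_≡_; _≢_; refl; sym; trans; cong; cong₂; subst; setoid; module ≡-Reasoning)
open import Relation.Nullary using (yes; no; ¬?)
open import Relation.Unary using (Pred; Decidable)

private
  variable
    c d m n r : ℕ
    X : Set

-- Duplicate-free lists and splitting a list by a predicate.

length-mono-⊆ : {xs ys : List X} → Unique xs → (∀ {x} → x ∈ xs → x ∈ ys) → length xs ≤ length ys
length-mono-⊆ {xs = []} [] sub = z≤n
length-mono-⊆ {xs = x ∷ xs} (x∉ ∷ uniq) sub with ∈-∃++ (sub (here refl))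
... | as , bs , refl = begin
  suc (length xs)               ≤⟨ s≤s (length-mono-⊆ uniq sub′) ⟩
  suc (length (as ++ bs))       ≡⟨ cong suc (length-++ as) ⟩
  suc (length as + length bs)   ≡⟨ +-suc (length as) (length bs) ⟨
  length as + suc (length bs)   ≡⟨ length-++ as ⟨
  length (as ++ x ∷ bs)         ∎
  where
  open ≤-Reasoning
  sub′ : ∀ {y} → y ∈ xs → y ∈ as ++ bs
  sub′ y∈ with ∈-++⁻ as (sub (there y∈))
  ... | inj₁ y∈as         = ∈-++⁺ˡ y∈as
  ... | inj₂ (here y≡x)   = ⊥-elim (All.lookup x∉ y∈ (sym y≡x))
  ... | inj₂ (there y∈bs) = ∈-++⁺ʳ as y∈bs

filter-++-↭ : {P : Pred X 0ℓ} (P? : Decidable P) (xs : List X) →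
              filter P? xs ++ filter (¬? ∘ P?) xs ↭ xs
filter-++-↭ P? [] = ↭-refl
filter-++-↭ P? (x ∷ xs) with P? x
... | yes _ = prep x (filter-++-↭ P? xs)
... | no  _ = ↭-trans (shift x (filter P? xs) _) (prep x (filter-++-↭ P? xs))

-- Lengths of paths through lists of points.

pathFrom : (X → X → ℕ) → X → List X → ℕ
pathFrom D u []       = 0
pathFrom D u (v ∷ vs) = D u v + pathFrom D v vs

path : (X → X → ℕ) → List X → ℕ
path D []       = 0
path D (v ∷ vs) = pathFrom D v vs

path≤pathFrom : (D : X → X → ℕ) → ∀ u vs → path D vs ≤ pathFrom D u vs
path≤pathFrom D u []       = z≤n
path≤pathFrom D u (v ∷ vs) = m≤n+m _ (D u v)

-- Only the first edge depends on the starting point, so one triangle inequality suffices. This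
-- serves to leave a flipped vector through its copy, and to skip vertices that carry no row.
pathFrom-reroute : (D : X → X → ℕ) → (∀ u v w → D u w ≤ D u v + D v w) →
                   ∀ u v vs → pathFrom D u vs ≤ D u v + pathFrom D v vs
pathFrom-reroute D tri u v [] = z≤n
pathFrom-reroute D tri u v (x ∷ xs) = begin
  D u x + pathFrom D x xs           ≤⟨ +-monoˡ-≤ _ (tri u v x) ⟩
  D u v + D v x + pathFrom D x xs   ≡⟨ +-assoc (D u v) _ _ ⟩
  D u v + (D v x + pathFrom D x xs) ∎
  where open ≤-Reasoning

-- Weighted Hamming distance.

diff-refl : ∀ x → diff x x ≡ 0
diff-refl false = refl
diff-refl true  = refl

diff-not : ∀ x → diff x (not x) ≡ 1
diff-not false = refl
diff-not true  = refl

diff-not′ : ∀ x → diff (not x) x ≡ 1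
diff-not′ false = refl
diff-not′ true  = refl

diff≤1 : ∀ x y → diff x y ≤ 1
diff≤1 false false = z≤n
diff≤1 false true  = ≤-refl
diff≤1 true  false = ≤-refl
diff≤1 true  true  = z≤n

diff-triangle : ∀ x y z → diff x z ≤ diff x y + diff y z
diff-triangle false false z     = ≤-refl
diff-triangle true  true  z     = ≤-refl
diff-triangle false true  z     = ≤-trans (diff≤1 false z) (m≤m+n 1 _)
diff-triangle true  false z     = ≤-trans (diff≤1 true z) (m≤m+n 1 _)

wdist : Vec ℕ c → Vec Bool c → Vec Bool c → ℕ
wdist []       []      []      = 0
wdist (w ∷ ws) (x ∷ u) (y ∷ v) = w * diff x y + wdist ws u v

wdist-refl : (w : Vec ℕ c) (u : Vec Bool c) → wdist w u u ≡ 0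
wdist-refl []       []      = refl
wdist-refl (w ∷ ws) (x ∷ u) rewrite diff-refl x | *-zeroʳ w = wdist-refl ws u

wdist-triangle : (w : Vec ℕ c) (u v z : Vec Bool c) → wdist w u z ≤ wdist w u v + wdist w v z
wdist-triangle []       []      []      []      = z≤n
wdist-triangle (k ∷ w) (x ∷ u) (y ∷ v) (t ∷ z) = begin
  k * diff x t + wdist w u z
    ≤⟨ +-mono-≤ (*-monoʳ-≤ k (diff-triangle x y t)) (wdist-triangle w u v z) ⟩
  k * (diff x y + diff y t) + (wdist w u v + wdist w v z)
    ≡⟨ rearrange k (diff x y) (diff y t) (wdist w u v) (wdist w v z) ⟩
  (k * diff x y + wdist w u v) + (k * diff y t + wdist w v z) ∎
  where
  open ≤-Reasoning
  rearrange : ∀ k a b p q → k * (a + b) + (p + q) ≡ (k * a + p) + (k * b + q)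
  rearrange = solve-∀

swap-heads : ∀ a b c → a + (b + c) ≡ b + (a + c)
swap-heads = solve-∀

wdist-insertAt : (w : Vec ℕ (suc c)) (b : Fin (suc c)) (u v : Vec Bool c) (x y : Bool) →
                 wdist w (insertAt u b x) (insertAt v b y) ≡
                 Vec.lookup w b * diff x y + wdist (removeAt w b) u v
wdist-insertAt (k ∷ w)     zero    u       v       x y = refl
wdist-insertAt (k ∷ l ∷ w) (suc b) (s ∷ u) (t ∷ v) x y
  rewrite wdist-insertAt (l ∷ w) b u v x y =
  swap-heads (k * diff s t) (Vec.lookup (l ∷ w) b * diff x y) (wdist (removeAt (l ∷ w) b) u v)

wdist-updateAt : (w : Vec ℕ c) (i : Fin c) (k : ℕ) (u v : Vec Bool c) →
                 wdist (updateAt w i (_+ k)) u v ≡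
                 k * diff (Vec.lookup u i) (Vec.lookup v i) + wdist w u v
wdist-updateAt (l ∷ w) zero    k (x ∷ u) (y ∷ v) = rearrange l k (diff x y) _
  where
  rearrange : ∀ l k a p → (l + k) * a + p ≡ k * a + (l * a + p)
  rearrange = solve-∀
wdist-updateAt (l ∷ w) (suc i) k (x ∷ u) (y ∷ v)
  rewrite wdist-updateAt w i k u v =
  swap-heads (l * diff x y) (k * diff (Vec.lookup u i) (Vec.lookup v i)) (wdist w u v)

-- The potential Σ w log w pays for the lighter weight at each merge

total : (ℕ → ℕ) → Vec ℕ c → ℕ
total g []      = 0
total g (k ∷ w) = g k + total g w

total-removeAt : ∀ g (w : Vec ℕ (suc c)) b → total g w ≡ g (Vec.lookup w b) + total g (removeAt w b)
total-removeAt g (k ∷ w)     zero    = refl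
total-removeAt g (k ∷ l ∷ w) (suc b) rewrite total-removeAt g (l ∷ w) b =
  swap-heads (g k) (g (Vec.lookup (l ∷ w) b)) (total g (removeAt (l ∷ w) b))

-- The old value is added on one side rather than subtracted on the other, which avoids truncated
-- subtraction; callers cancel it.
total-updateAt : ∀ g (w : Vec ℕ c) i f →
                 total g (updateAt w i f) + g (Vec.lookup w i) ≡ g (f (Vec.lookup w i)) + total g w
total-updateAt g (k ∷ w) zero    f = rearrange (g (f k)) (total g w) (g k)
  where
  rearrange : ∀ a b c → a + b + c ≡ a + (c + b)
  rearrange = solve-∀
total-updateAt g (k ∷ w) (suc i) f = begin
  g k + total g (updateAt w i f) + g (Vec.lookup w i)   ≡⟨ +-assoc (g k) _ _ ⟩
  g k + (total g (updateAt w i f) + g (Vec.lookup w i)) ≡⟨ cong (g k +_) (total-updateAt g w i f) ⟩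
  g k + (g (f (Vec.lookup w i)) + total g w)            ≡⟨ swap-heads (g k) (g (f (Vec.lookup w i))) (total g w) ⟩
  g (f (Vec.lookup w i)) + (g k + total g w)            ∎
  where open ≡-Reasoning

total-replicate : ∀ n → total id (replicate n 1) ≡ n
total-replicate zero    = refl
total-replicate (suc n) = cong suc (total-replicate n)

nlogn : ℕ → ℕ
nlogn k = k * ⌊log₂ k ⌋

-- From `b ≤ a` follows `2 * b ≤ a + b`, so the logarithm attached to `b` grows by at least one when
-- `b` joins `a`. This gain is the extra summand `b`.
nlogn-superadditive : ∀ a b → b ≤ a → nlogn b + nlogn a + b ≤ nlogn (a + b)
-- Zero is treated apart because doubling does not raise `⌊log₂ 0 ⌋`.
nlogn-superadditive a zero    _   rewrite +-identityʳ a | +-identityʳ (nlogn a) = ≤-refl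
nlogn-superadditive a b@(suc _) b≤a = begin
  b * ⌊log₂ b ⌋ + a * ⌊log₂ a ⌋ + b             ≡⟨ rearrange b ⌊log₂ b ⌋ (a * ⌊log₂ a ⌋) ⟩
  a * ⌊log₂ a ⌋ + b * (1 + ⌊log₂ b ⌋)           ≡⟨ cong (λ l → a * ⌊log₂ a ⌋ + b * l) (⌊log₂[2*b]⌋≡1+⌊log₂b⌋ b) ⟨
  a * ⌊log₂ a ⌋ + b * ⌊log₂ (2 * b) ⌋           ≤⟨ +-mono-≤ (*-monoʳ-≤ a (⌊log₂⌋-mono-≤ (m≤m+n a b)))
                                                            (*-monoʳ-≤ b (⌊log₂⌋-mono-≤ 2b≤a+b)) ⟩
  a * ⌊log₂ (a + b) ⌋ + b * ⌊log₂ (a + b) ⌋     ≡⟨ *-distribʳ-+ ⌊log₂ (a + b) ⌋ a b ⟨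
  (a + b) * ⌊log₂ (a + b) ⌋                     ∎
  where
  open ≤-Reasoning
  rearrange : ∀ b l p → b * l + p + b ≡ p + b * (1 + l)
  rearrange = solve-∀
  2b≤a+b : 2 * b ≤ a + b
  2b≤a+b = +-mono-≤ b≤a (≤-reflexive (+-identityʳ b))

-- The target `i` is a position after the deletion of `b`, that is `punchIn b i` in `w`. It thereby
-- agrees with the index of the merged column in the merged matrix.
moveWeight : Vec ℕ (suc c) → Fin (suc c) → Fin c → Vec ℕ c
moveWeight w b i = updateAt (removeAt w b) i (_+ Vec.lookup w b)

total-moveWeight : (w : Vec ℕ (suc c)) (b : Fin (suc c)) (i : Fin c) →
                   total id (moveWeight w b i) ≡ total id w
total-moveWeight w b i = +-cancelʳ-≡ a _ _ (begin
  total id (moveWeight w b i) + a                  ≡⟨ total-updateAt id (removeAt w b) i _ ⟩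
  a + Vec.lookup w b + total id (removeAt w b)     ≡⟨ +-assoc a _ _ ⟩
  a + (Vec.lookup w b + total id (removeAt w b))   ≡⟨ cong (a +_) (total-removeAt id w b) ⟨
  a + total id w                                   ≡⟨ +-comm a _ ⟩
  total id w + a                                   ∎)
  where
  open ≡-Reasoning
  a = Vec.lookup (removeAt w b) i

potential-moveWeight : (w : Vec ℕ (suc c)) (b : Fin (suc c)) (i : Fin c) →
                       Vec.lookup w b ≤ Vec.lookup (removeAt w b) i →
                       total nlogn w + Vec.lookup w b ≤ total nlogn (moveWeight w b i)
potential-moveWeight w b i β≤α = +-cancelʳ-≤ (nlogn α) _ _ (begin
  total nlogn w + β + nlogn α                  ≡⟨ cong (λ t → t + β + nlogn α) (total-removeAt nlogn w b) ⟩
  nlogn β + rest + β + nlogn α                 ≡⟨ rearrange (nlogn β) rest β (nlogn α) ⟩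
  nlogn β + nlogn α + β + rest                 ≤⟨ +-monoˡ-≤ rest (nlogn-superadditive α β β≤α) ⟩
  nlogn (α + β) + rest                         ≡⟨ total-updateAt nlogn (removeAt w b) i (_+ β) ⟨
  total nlogn (moveWeight w b i) + nlogn α     ∎)
  where
  open ≤-Reasoning
  α = Vec.lookup (removeAt w b) i
  β = Vec.lookup w b
  rest = total nlogn (removeAt w b)
  rearrange : ∀ p q r s → p + q + r + s ≡ p + s + r + q
  rearrange = solve-∀

-- Boolean vectors compatible with a row of entries

choices : Entry → List Bool
choices e0  = false ∷ []
choices e1  = true ∷ []
choices err = false ∷ true ∷ []

Admits : (Fin c → Entry) → (Fin c → Bool) → Set
Admits f u = ∀ j → u j ∈ choices (f j)

vectors : (Fin c → Entry) → List (Vec Bool c)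
vectors {zero}  f = [] ∷ []
vectors {suc c} f = cartesianProductWith _∷_ (choices (f zero)) (vectors (f ∘ suc))

admits⇒∈vectors : (f : Fin c → Entry) (v : Vec Bool c) → Admits f (Vec.lookup v) → v ∈ vectors f
admits⇒∈vectors f []      adm = here refl
admits⇒∈vectors f (x ∷ v) adm =
  ∈-cartesianProductWith⁺ _∷_ (adm zero) (admits⇒∈vectors (f ∘ suc) v (adm ∘ suc))

length-cartesianProductWith : {Y Z : Set} (f : X → Y → Z) (xs : List X) (ys : List Y) →
                              length (cartesianProductWith f xs ys) ≡ length xs * length ys
length-cartesianProductWith f []       ys = refl
length-cartesianProductWith f (x ∷ xs) ys = trans (length-++ (map (f x) ys))
  (cong₂ _+_ (length-map (f x) ys) (length-cartesianProductWith f xs ys))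

length-choices : ∀ e → length (choices e) ≡ 2 ^ isErr e
length-choices e0  = refl
length-choices e1  = refl
length-choices err = refl

-- Each error leaves both bits open, every other entry exactly one.
length-vectors : (f : Fin c → Entry) → length (vectors f) ≡ 2 ^ countErr f
length-vectors {zero}  f = refl
length-vectors {suc c} f = begin
  length (vectors f)
    ≡⟨ length-cartesianProductWith _∷_ (choices (f zero)) (vectors (f ∘ suc)) ⟩
  length (choices (f zero)) * length (vectors (f ∘ suc))
    ≡⟨ cong₂ _*_ (length-choices (f zero)) (length-vectors (f ∘ suc)) ⟩
  2 ^ isErr (f zero) * 2 ^ countErr (f ∘ suc)
    ≡⟨ ^-distribˡ-+-* 2 (isErr (f zero)) (countErr (f ∘ suc)) ⟨
  2 ^ countErr f ∎
  where open ≡-Reasoning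

onErr : Entry → List X → List X
onErr err xs = xs
onErr _   xs = []

-- These are the vectors that may need a second variant when the merge producing column `i` is
-- undone. Repetitions are harmless, as only an upper bound on the length is needed.
errVectors : Mat r c → Fin c → List (Vec Bool c)
errVectors {zero}  A i = []
errVectors {suc r} A i = onErr (A zero i) (vectors (A zero)) ++ errVectors (A ∘ suc) i

length-onErr : ∀ e (xs : List X) → length (onErr e xs) ≡ isErr e * length xs
length-onErr e0  xs = refl
length-onErr e1  xs = refl
length-onErr err xs = sym (+-identityʳ _)

length-errVectors : (A : Mat r c) (i : Fin c) → (∀ p → countErr (A p) ≤ d) →
                    length (errVectors A i) ≤ countErr (λ p → A p i) * 2 ^ d
length-errVectors {zero}          A i rows = z≤n
length-errVectors {suc r} {d = d} A i rows = begin
  length (onErr e (vectors (A zero)) ++ errVectors (A ∘ suc) i)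
    ≡⟨ length-++ (onErr e (vectors (A zero))) ⟩
  length (onErr e (vectors (A zero))) + length (errVectors (A ∘ suc) i)
    ≡⟨ cong (_+ length (errVectors (A ∘ suc) i)) (length-onErr e (vectors (A zero))) ⟩
  isErr e * length (vectors (A zero)) + length (errVectors (A ∘ suc) i)
    ≡⟨ cong (λ l → isErr e * l + length (errVectors (A ∘ suc) i)) (length-vectors (A zero)) ⟩
  isErr e * 2 ^ countErr (A zero) + length (errVectors (A ∘ suc) i)
    ≤⟨ +-mono-≤ (*-monoʳ-≤ (isErr e) (^-monoʳ-≤ 2 (rows zero)))
                (length-errVectors (A ∘ suc) i (rows ∘ suc)) ⟩
  isErr e * 2 ^ d + countErr (λ p → A (suc p) i) * 2 ^ d
    ≡⟨ *-distribʳ-+ (2 ^ d) (isErr e) _ ⟨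
  countErr (λ p → A p i) * 2 ^ d ∎
  where
  open ≤-Reasoning
  e = A zero i

∈-errVectors : (A : Mat r c) (i : Fin c) → ∀ p {v} → A p i ≡ err → v ∈ vectors (A p) → v ∈ errVectors A i
∈-errVectors A i zero    eq v∈ rewrite eq = ∈-++⁺ˡ v∈
∈-errVectors A i (suc p) eq v∈ = ∈-++⁺ʳ (onErr (A zero i) _) (∈-errVectors (A ∘ suc) i p eq v∈)

-- Merging and compatibility

∈choices-err : ∀ x → x ∈ choices err
∈choices-err false = here refl
∈choices-err true  = there (here refl)

∈choices-mergeEˡ : ∀ {x} e f → x ∈ choices e → x ∈ choices (mergeE e f)
∈choices-mergeEˡ e0  e0  x∈ = x∈
∈choices-mergeEˡ e1  e1  x∈ = x∈
∈choices-mergeEˡ e0  e1  x∈ = ∈choices-err _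
∈choices-mergeEˡ e0  err x∈ = ∈choices-err _
∈choices-mergeEˡ e1  e0  x∈ = ∈choices-err _
∈choices-mergeEˡ e1  err x∈ = ∈choices-err _
∈choices-mergeEˡ err e0  x∈ = x∈
∈choices-mergeEˡ err e1  x∈ = x∈
∈choices-mergeEˡ err err x∈ = x∈

mergeE-comm : ∀ e f → mergeE e f ≡ mergeE f e
mergeE-comm e0  e0  = refl
mergeE-comm e0  e1  = refl
mergeE-comm e0  err = refl
mergeE-comm e1  e0  = refl
mergeE-comm e1  e1  = refl
mergeE-comm e1  err = refl
mergeE-comm err e0  = refl
mergeE-comm err e1  = refl
mergeE-comm err err = refl

∈choices-mergeEʳ : ∀ {x} e f → x ∈ choices f → x ∈ choices (mergeE e f)
∈choices-mergeEʳ e f x∈ rewrite mergeE-comm e f = ∈choices-mergeEˡ f e x∈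

mergeE-≢ : ∀ {x y} e f → x ∈ choices e → y ∈ choices f → x ≢ y → mergeE e f ≡ err
mergeE-≢ e0  e0  (here refl) (here refl) x≢y = ⊥-elim (x≢y refl)
mergeE-≢ e1  e1  (here refl) (here refl) x≢y = ⊥-elim (x≢y refl)
mergeE-≢ e0  e1  _ _ _ = refl
mergeE-≢ e0  err _ _ _ = refl
mergeE-≢ e1  e0  _ _ _ = refl
mergeE-≢ e1  err _ _ _ = refl
mergeE-≢ err e0  _ _ _ = refl
mergeE-≢ err e1  _ _ _ = refl
mergeE-≢ err err _ _ _ = refl

-- Merging rows only enlarges the sets of choices, so a list covering the merged rows covers the
-- original ones too. Hence row merges cost nothing.
mergeRows-admits : (A : Mat (suc (suc r)) c) (i : Fin (suc r)) → ∀ p →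
                   ∃ λ q → ∀ {u} → Admits (A p) u → Admits (mergeRows A i q) u
mergeRows-admits A zero zero          = zero , λ adm j → ∈choices-mergeEˡ _ _ (adm j)
mergeRows-admits A zero (suc zero)    = zero , λ adm j → ∈choices-mergeEʳ (A zero j) _ (adm j)
mergeRows-admits A zero (suc (suc p)) = suc p , λ adm → adm
mergeRows-admits {suc r} A (suc i) zero    = zero , λ adm → adm
mergeRows-admits {suc r} A (suc i) (suc p) with mergeRows-admits (A ∘ suc) i p
... | q , imp = suc q , λ adm → imp adm

-- The second index is the column to drop among the two that merge into column `i`; either of them
-- may be the lighter one.
data MergedPair : Fin (suc c) → Fin (suc (suc c)) → Set where
  left  : (i : Fin (suc c)) → MergedPair i (inject₁ i)
  right : (i : Fin (suc c)) → MergedPair i (suc i)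

mergeCols-admits : (A : Mat r (suc (suc c))) {i : Fin (suc c)} {b : Fin (suc (suc c))} → MergedPair i b →
                   ∀ p {u} → Admits (A p) u → Admits (mergeCols A i p) (u ∘ punchIn b)
mergeCols-admits A (left zero)  p adm zero    = ∈choices-mergeEʳ (A p zero) _ (adm (suc zero))
mergeCols-admits A (right zero) p adm zero    = ∈choices-mergeEˡ (A p zero) _ (adm zero)
mergeCols-admits A (left zero)  p adm (suc j) = adm (suc (suc j))
mergeCols-admits A (right zero) p adm (suc j) = adm (suc (suc j))
mergeCols-admits {c = suc _} A (left (suc i))  p adm zero    = adm zero
mergeCols-admits {c = suc _} A (right (suc i)) p adm zero    = adm zero
mergeCols-admits {c = suc _} A (left (suc i))  p adm (suc j) =
  mergeCols-admits (λ q k → A q (suc k)) (left i) p (adm ∘ suc) j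
mergeCols-admits {c = suc _} A (right (suc i)) p adm (suc j) =
  mergeCols-admits (λ q k → A q (suc k)) (right i) p (adm ∘ suc) j

-- Two entries that allow different bits cannot be the same definite bit, so their merge is an
-- error. Hence only vectors in `errVectors` can require a flipped variant.
mergeCols-err : (A : Mat r (suc (suc c))) {i : Fin (suc c)} {b : Fin (suc (suc c))} → MergedPair i b →
                ∀ p {u} → Admits (A p) u → u b ≢ u (punchIn b i) → mergeCols A i p i ≡ err
mergeCols-err A (left zero)  p adm u≢ = mergeE-≢ _ _ (adm zero) (adm (suc zero)) u≢
mergeCols-err A (right zero) p adm u≢ = mergeE-≢ _ _ (adm zero) (adm (suc zero)) (u≢ ∘ sym)
mergeCols-err {c = suc _} A (left (suc i))  p adm u≢ =
  mergeCols-err (λ q k → A q (suc k)) (left i) p (adm ∘ suc) u≢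
mergeCols-err {c = suc _} A (right (suc i)) p adm u≢ =
  mergeCols-err (λ q k → A q (suc k)) (right i) p (adm ∘ suc) u≢

lookup-removeAt : (v : Vec X (suc c)) (b : Fin (suc c)) (j : Fin c) →
                  Vec.lookup (removeAt v b) j ≡ Vec.lookup v (punchIn b j)
lookup-removeAt (x ∷ v)     zero    j       = refl
lookup-removeAt (x ∷ y ∷ v) (suc b) zero    = refl
lookup-removeAt (x ∷ y ∷ v) (suc b) (suc j) = lookup-removeAt (y ∷ v) b j

-- Undoing a column merge

module Expand (E : List (Vec Bool c)) (b : Fin (suc c)) (i : Fin c) where

  open import Data.List.Membership.DecPropositional (≡-dec {n = c} _≟ᵇ_) using (_∈?_)

  copy flip : Vec Bool c → Vec Bool (suc c)
  copy v = insertAt v b (Vec.lookup v i)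
  flip v = insertAt v b (not (Vec.lookup v i))

  -- A flipped variant stands directly after its copy, from which it differs in coordinate `b`
  -- alone, so inserting it is a cheap detour. Only vectors in `E` receive one, which keeps the
  -- detours few.
  expand : List (Vec Bool c) → List (Vec Bool (suc c))
  expand [] = []
  expand (v ∷ vs) with v ∈? E
  ... | yes _ = copy v ∷ flip v ∷ expand vs
  ... | no  _ = copy v ∷ expand vs

  removeAt-expand : ∀ vs {y} → y ∈ expand vs → removeAt y b ∈ vs
  removeAt-expand (v ∷ vs) y∈ with v ∈? E
  removeAt-expand (v ∷ vs) (here refl)         | yes _ = here (removeAt-insertAt v b _)
  removeAt-expand (v ∷ vs) (there (here refl)) | yes _ = here (removeAt-insertAt v b _)
  removeAt-expand (v ∷ vs) (there (there y∈))  | yes _ = there (removeAt-expand vs y∈)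
  removeAt-expand (v ∷ vs) (here refl)         | no  _ = here (removeAt-insertAt v b _)
  removeAt-expand (v ∷ vs) (there y∈)          | no  _ = there (removeAt-expand vs y∈)

  insertAt-∉-expand : ∀ {v vs} x → All (v ≢_) vs → All (insertAt v b x ≢_) (expand vs)
  insertAt-∉-expand {v} {vs} x v∉ = All.tabulate λ {y} y∈ eq →
    All.lookup v∉ (removeAt-expand vs y∈)
      (trans (sym (removeAt-insertAt v b x)) (cong (λ z → removeAt z b) eq))

  copy≢flip : ∀ v → copy v ≢ flip v
  copy≢flip v eq = x≢notx _ (trans (sym (insertAt-lookup v b _)) (trans (cong (λ z → Vec.lookup z b) eq) (insertAt-lookup v b _)))
    where
    x≢notx : ∀ x → x ≢ not x
    x≢notx false ()
    x≢notx true  ()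

  expand-unique : ∀ {vs} → Unique vs → Unique (expand vs)
  expand-unique [] = []
  expand-unique {v ∷ vs} (v∉ ∷ uniq) with v ∈? E
  ... | yes _ = (copy≢flip v All.∷ insertAt-∉-expand _ v∉) ∷ insertAt-∉-expand _ v∉ ∷ expand-unique uniq
  ... | no  _ = insertAt-∉-expand _ v∉ ∷ expand-unique uniq

  ∈-expand-copy : ∀ {v vs} → v ∈ vs → copy v ∈ expand vs
  ∈-expand-copy {vs = x ∷ vs} v∈ with x ∈? E
  ∈-expand-copy (here refl) | yes _ = here refl
  ∈-expand-copy (there v∈)  | yes _ = there (there (∈-expand-copy v∈))
  ∈-expand-copy (here refl) | no  _ = here refl
  ∈-expand-copy (there v∈)  | no  _ = there (∈-expand-copy v∈)

  ∈-expand-flip : ∀ {v vs} → v ∈ E → v ∈ vs → flip v ∈ expand vs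
  ∈-expand-flip {vs = x ∷ vs} v∈E v∈ with x ∈? E
  ∈-expand-flip v∈E (here refl) | yes _   = there (here refl)
  ∈-expand-flip v∈E (there v∈)  | yes _   = there (there (∈-expand-flip v∈E v∈))
  ∈-expand-flip v∈E (here refl) | no  v∉E = ⊥-elim (v∉E v∈E)
  ∈-expand-flip v∈E (there v∈)  | no  _   = there (∈-expand-flip v∈E v∈)

  -- If coordinate `b` agrees with the surviving coordinate, `y` is the copy of its restriction.
  -- Otherwise it is the flip, and `flagged` guarantees that the flip was inserted.
  ∈-expand : ∀ {vs} y → removeAt y b ∈ vs →
             (Vec.lookup y b ≢ Vec.lookup y (punchIn b i) → removeAt y b ∈ E) → y ∈ expand vs
  ∈-expand {vs} y y′∈ flagged with Vec.lookup y b ≟ᵇ Vec.lookup y (punchIn b i)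
  ... | yes eq = subst (_∈ expand vs) restore (∈-expand-copy y′∈)
    where
    restore : copy (removeAt y b) ≡ y
    restore = trans (cong (insertAt (removeAt y b) b) (trans (lookup-removeAt y b i) (sym eq)))
                    (insertAt-removeAt y b)
  ... | no neq = subst (_∈ expand vs) restore (∈-expand-flip (flagged neq) y′∈)
    where
    ≢⇒not : ∀ x z → x ≢ z → not z ≡ x
    ≢⇒not false false x≢z = ⊥-elim (x≢z refl)
    ≢⇒not false true  _   = refl
    ≢⇒not true  false _   = refl
    ≢⇒not true  true  x≢z = ⊥-elim (x≢z refl)
    restore : flip (removeAt y b) ≡ y
    restore = trans (cong (insertAt (removeAt y b) b) (trans (cong not (lookup-removeAt y b i)) (≢⇒not _ _ neq)))
                    (insertAt-removeAt y b)

  module _ (w : Vec ℕ (suc c)) where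

    private
      β  = Vec.lookup w b
      D  = wdist w
      D′ = wdist (moveWeight w b i)

    -- In copies, coordinate `b` repeats coordinate `i`, so its weight acts as additional weight on
    -- `i`.
    wdist-copy : ∀ u v → D (copy u) (copy v) ≡ D′ u v
    wdist-copy u v = trans (wdist-insertAt w b u v _ _) (sym (wdist-updateAt (removeAt w b) i β u v))

    wdist-copy-flip : ∀ v → D (copy v) (flip v) ≡ β
    wdist-copy-flip v
      rewrite wdist-insertAt w b v v (Vec.lookup v i) (not (Vec.lookup v i))
            | diff-not (Vec.lookup v i) | wdist-refl (removeAt w b) v
      = trans (+-identityʳ _) (*-identityʳ β)

    wdist-flip-copy : ∀ v → D (flip v) (copy v) ≡ β
    wdist-flip-copy v
      rewrite wdist-insertAt w b v v (not (Vec.lookup v i)) (Vec.lookup v i)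
            | diff-not′ (Vec.lookup v i) | wdist-refl (removeAt w b) v
      = trans (+-identityʳ _) (*-identityʳ β)

    flagged-count : List (Vec Bool c) → ℕ
    flagged-count vs = length (filter (_∈? E) vs)

    -- Going to the flip costs `β`, and returning to the copy before continuing costs `β` again; by
    -- the triangle inequality, continuing directly from the flip is no longer.
    detour : ∀ v xs → D (copy v) (flip v) + pathFrom D (flip v) xs ≤ 2 * β + pathFrom D (copy v) xs
    detour v xs = begin
      D (copy v) (flip v) + pathFrom D (flip v) xs
        ≤⟨ +-mono-≤ (≤-reflexive (wdist-copy-flip v)) (pathFrom-reroute D (wdist-triangle w) (flip v) (copy v) xs) ⟩
      β + (D (flip v) (copy v) + pathFrom D (copy v) xs)
        ≡⟨ cong (λ t → β + (t + pathFrom D (copy v) xs)) (wdist-flip-copy v) ⟩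
      β + (β + pathFrom D (copy v) xs)
        ≡⟨ rearrange β _ ⟩
      2 * β + pathFrom D (copy v) xs ∎
      where
      open ≤-Reasoning
      rearrange : ∀ b p → b + (b + p) ≡ 2 * b + p
      rearrange = solve-∀

    pathFrom-expand : ∀ u vs → pathFrom D (copy u) (expand vs) ≤ pathFrom D′ u vs + flagged-count vs * (2 * β)
    pathFrom-expand u [] = z≤n
    pathFrom-expand u (v ∷ vs) with v ∈? E
    ... | yes _ = begin
      D (copy u) (copy v) + (D (copy v) (flip v) + pathFrom D (flip v) (expand vs))
        ≤⟨ +-mono-≤ (≤-reflexive (wdist-copy u v)) (detour v (expand vs)) ⟩
      D′ u v + (2 * β + pathFrom D (copy v) (expand vs))
        ≤⟨ +-monoʳ-≤ (D′ u v) (+-monoʳ-≤ (2 * β) (pathFrom-expand v vs)) ⟩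
      D′ u v + (2 * β + (pathFrom D′ v vs + flagged-count vs * (2 * β)))
        ≡⟨ rearrange (D′ u v) (2 * β) (pathFrom D′ v vs) (flagged-count vs) ⟩
      D′ u v + pathFrom D′ v vs + suc (flagged-count vs) * (2 * β) ∎
      where
      open ≤-Reasoning
      rearrange : ∀ a t p k → a + (t + (p + k * t)) ≡ a + p + suc k * t
      rearrange = solve-∀
    ... | no _ = begin
      D (copy u) (copy v) + pathFrom D (copy v) (expand vs)
        ≤⟨ +-mono-≤ (≤-reflexive (wdist-copy u v)) (pathFrom-expand v vs) ⟩
      D′ u v + (pathFrom D′ v vs + flagged-count vs * (2 * β))
        ≡⟨ +-assoc (D′ u v) _ _ ⟨
      D′ u v + pathFrom D′ v vs + flagged-count vs * (2 * β) ∎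
      where open ≤-Reasoning

    path-expand : ∀ vs → path D (expand vs) ≤ path D′ vs + flagged-count vs * (2 * β)
    path-expand [] = z≤n
    path-expand (v ∷ vs) with v ∈? E
    ... | no _ = pathFrom-expand v vs
    ... | yes _ = begin
      D (copy v) (flip v) + pathFrom D (flip v) (expand vs)       ≤⟨ detour v (expand vs) ⟩
      2 * β + pathFrom D (copy v) (expand vs)                     ≤⟨ +-monoʳ-≤ (2 * β) (pathFrom-expand v vs) ⟩
      2 * β + (pathFrom D′ v vs + flagged-count vs * (2 * β))     ≡⟨ swap-heads (2 * β) (pathFrom D′ v vs) (flagged-count vs * (2 * β)) ⟩
      pathFrom D′ v vs + suc (flagged-count vs) * (2 * β)         ∎
      where open ≤-Reasoning

    -- In a list without repetitions each vector of `E` is flagged at most once, so there are at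
    -- most `length E` detours.
    path-expand-unique : ∀ {vs} → Unique vs → path D (expand vs) ≤ path D′ vs + length E * (2 * β)
    path-expand-unique {vs} uniq = ≤-trans (path-expand vs) (+-monoʳ-≤ (path D′ vs) (*-monoˡ-≤ (2 * β)
      (length-mono-⊆ (filter⁺ (_∈? E) uniq) (λ x∈ → proj₂ (∈-filter⁻ (_∈? E) {xs = vs} x∈)))))

-- Short paths from merge sequences

-- At most `d * 2 ^ d` vectors are flagged per column merge, and each detour crosses the dropped
-- coordinate at most twice.
factor : ℕ → ℕ
factor d = d * 2 ^ d * 2

-- The list covers every vector that the current entries allow, whether or not it is a row of the
-- original matrix, so the invariant refers to the current matrix alone.
record ShortPath (d : ℕ) (A : Mat r c) (w : Vec ℕ c) : Set where
  field
    vertices : List (Vec Bool c)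
    unique   : Unique vertices
    covers   : ∀ p v → Admits (A p) (Vec.lookup v) → v ∈ vertices
    -- The potential on the left is what has already been paid for by earlier merges.
    short    : path (wdist w) vertices + factor d * total nlogn w ≤
               factor d * nlogn (total id w) + total id w

open ShortPath

mergeSeq⇒errBounded : {A : Mat r c} → MergeSeq d A → ErrBounded d A
mergeSeq⇒errBounded (single _ eb)       = eb
mergeSeq⇒errBounded (rowMerge _ _ eb _) = eb
mergeSeq⇒errBounded (colMerge _ _ eb _) = eb

shortPath-single : (A : Mat 1 1) (w : Vec ℕ 1) → ShortPath d A w
shortPath-single A w .vertices = (false ∷ []) ∷ (true ∷ []) ∷ []
shortPath-single A w .unique   = ((λ ()) All.∷ All.[]) ∷ All.[] ∷ []
shortPath-single A w .covers p (false ∷ []) _ = here refl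
shortPath-single A w .covers p (true ∷ [])  _ = there (here refl)
-- For a single column the potential equals the `nlogn` term on the right. What remains is the
-- distance `k` between the two vectors, which is `total id w`.
shortPath-single {d} A (k ∷ []) .short = ≤-reflexive
  (trans (rearrange k (factor d) (nlogn k)) (cong (λ t → factor d * nlogn t + t) (sym (+-identityʳ k))))
  where
  rearrange : ∀ k f l → k * 1 + 0 + 0 + f * (l + 0) ≡ f * l + k
  rearrange = solve-∀

shortPath-colMerge : (A : Mat r (suc (suc c))) {i : Fin (suc c)} {b : Fin (suc (suc c))} → MergedPair i b →
                     (w : Vec ℕ (suc (suc c))) → Vec.lookup w b ≤ Vec.lookup w (punchIn b i) →
                     ErrBounded d (mergeCols A i) → ShortPath d (mergeCols A i) (moveWeight w b i) →
                     ShortPath d A w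
shortPath-colMerge {d = d} A {i} {b} pair w β≤α (rowsOK , colsOK) S = λ where
    .vertices → expand (S .vertices)
    .unique   → expand-unique (S .unique)
    .covers p v adm →
      let adm′ : Admits (mergeCols A i p) (Vec.lookup (removeAt v b))
          adm′ j = subst (_∈ choices _) (sym (lookup-removeAt v b j)) (mergeCols-admits A pair p adm j)
      in ∈-expand v (S .covers p (removeAt v b) adm′)
           λ neq → ∈-errVectors (mergeCols A i) i p (mergeCols-err A pair p adm neq)
                     (admits⇒∈vectors _ (removeAt v b) adm′)
    .short → begin
      path (wdist w) (expand (S .vertices)) + factor d * total nlogn w
        ≤⟨ +-monoˡ-≤ _ (path-expand-unique w (S .unique)) ⟩
      P′ + length E * (2 * β) + factor d * total nlogn w
        -- The detours now cost at most `factor d * β`.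
        ≤⟨ +-monoˡ-≤ _ (+-monoʳ-≤ P′ (*-monoˡ-≤ (2 * β) length-E)) ⟩
      P′ + d * 2 ^ d * (2 * β) + factor d * total nlogn w
        ≡⟨ rearrange P′ (d * 2 ^ d) β (total nlogn w) ⟩
      P′ + factor d * (total nlogn w + β)
        -- The potential grows by at least `β` when the lighter weight moves, which pays for all
        -- detours of this merge.
        ≤⟨ +-monoʳ-≤ P′ (*-monoʳ-≤ (factor d) (potential-moveWeight w b i β≤α′)) ⟩
      P′ + factor d * total nlogn (moveWeight w b i)
        ≤⟨ S .short ⟩
      factor d * nlogn (total id (moveWeight w b i)) + total id (moveWeight w b i)
        ≡⟨ cong (λ t → factor d * nlogn t + t) (total-moveWeight w b i) ⟩
      factor d * nlogn (total id w) + total id w ∎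
  where
  open ≤-Reasoning
  E = errVectors (mergeCols A i) i
  open Expand E b i
  β = Vec.lookup w b
  P′ = path (wdist (moveWeight w b i)) (S .vertices)
  -- The error bounds used are those of the matrix after the merge: at most `d` rows have an error
  -- in the merged column, and each of these rows admits at most `2 ^ d` vectors.
  length-E : length E ≤ d * 2 ^ d
  length-E = ≤-trans (length-errVectors (mergeCols A i) i rowsOK) (*-monoˡ-≤ (2 ^ d) (colsOK i))
  β≤α′ : β ≤ Vec.lookup (removeAt w b) i
  β≤α′ = subst (β ≤_) (sym (lookup-removeAt w b i)) β≤α
  rearrange : ∀ p e b t → p + e * (2 * b) + e * 2 * t ≡ p + e * 2 * (t + b)
  rearrange = solve-∀

punchIn-inject₁ : (i : Fin (suc c)) → punchIn (inject₁ i) i ≡ suc i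
punchIn-inject₁ zero            = refl
punchIn-inject₁ {suc c} (suc i) = cong suc (punchIn-inject₁ i)

punchIn-suc : (i : Fin (suc c)) → punchIn (suc i) i ≡ inject₁ i
punchIn-suc zero            = refl
punchIn-suc {suc c} (suc i) = cong suc (punchIn-suc i)

-- Induction from the last merge backwards. The weights are arbitrary because the remaining sequence
-- has to be treated with the weights moved by the current merge.
shortPath : {A : Mat r c} → MergeSeq d A → (w : Vec ℕ c) → ShortPath d A w
shortPath (single A _) w = shortPath-single A w
shortPath (rowMerge A i _ seq) w = let S = shortPath seq w in λ where
  .vertices → S .vertices
  .unique   → S .unique
  .covers p v adm → S .covers _ v (proj₂ (mergeRows-admits A i p) adm)
  .short    → S .short
-- The lighter column is dropped, as the growth of the potential requires.
shortPath (colMerge A i _ seq) w with ≤-total (Vec.lookup w (suc i)) (Vec.lookup w (inject₁ i))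
... | inj₁ le = shortPath-colMerge A (right i) w (subst (λ j → Vec.lookup w (suc i) ≤ Vec.lookup w j) (sym (punchIn-suc i)) le)
                  (mergeSeq⇒errBounded seq) (shortPath seq _)
... | inj₂ le = shortPath-colMerge A (left i) w (subst (λ j → Vec.lookup w (inject₁ i) ≤ Vec.lookup w j) (sym (punchIn-inject₁ i)) le)
                  (mergeSeq⇒errBounded seq) (shortPath seq _)

-- Ordering the rows along a path of vectors

module Arrange {Y : Set} (_≟_ : DecidableEquality Y) (D : Y → Y → ℕ) (D-refl : ∀ v → D v v ≡ 0)
               (tri : ∀ u v w → D u w ≤ D u v + D v w) (key : X → Y) where

  hasKey? : ∀ v → Decidable (λ x → key x ≡ v)
  hasKey? v x = key x ≟ v

  arrange : List Y → List X → List X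
  -- Rows left over are kept, so the result is a permutation of `xs` even when `vs` misses some
  -- keys.
  arrange []       xs = xs
  arrange (v ∷ vs) xs = filter (hasKey? v) xs ++ arrange vs (filter (¬? ∘ hasKey? v) xs)

  arrange-↭ : ∀ vs xs → arrange vs xs ↭ xs
  arrange-↭ []       xs = ↭-refl
  arrange-↭ (v ∷ vs) xs = ↭-trans (++⁺ˡ (filter (hasKey? v) xs) (arrange-↭ vs _)) (filter-++-↭ (hasKey? v) xs)

  -- Steps inside a block have length zero. An empty block means that no row has key `v`, and then
  -- the triangle inequality allows `v` to be skipped.
  pathFrom-block : ∀ u v {xs} ys → All (λ x → key x ≡ v) xs →
                   pathFrom D u (map key (xs ++ ys)) ≤ D u v + pathFrom D v (map key ys)
  pathFrom-block u v ys All.[] = pathFrom-reroute D tri u v (map key ys)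
  pathFrom-block u v ys (refl All.∷ eqs) = +-monoʳ-≤ (D u v) (≤-trans (pathFrom-block v v ys eqs)
    (≤-reflexive (cong (_+ pathFrom D v (map key ys)) (D-refl v))))

  covered-tail : ∀ v {vs xs} → (∀ {x} → x ∈ xs → key x ∈ v ∷ vs) →
                 ∀ {x} → x ∈ filter (¬? ∘ hasKey? v) xs → key x ∈ vs
  covered-tail v {xs = xs} cov x∈ with ∈-filter⁻ (¬? ∘ hasKey? v) {xs = xs} x∈
  ... | x∈xs , key≢v with cov x∈xs
  ...   | here key≡v = ⊥-elim (key≢v key≡v)
  ...   | there key∈ = key∈

  pathFrom-arrange : ∀ u vs xs → (∀ {x} → x ∈ xs → key x ∈ vs) →
                     pathFrom D u (map key (arrange vs xs)) ≤ pathFrom D u vs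
  pathFrom-arrange u [] []       cov = z≤n
  pathFrom-arrange u [] (x ∷ xs) cov with cov (here refl)
  ... | ()
  pathFrom-arrange u (v ∷ vs) xs cov = ≤-trans
    (pathFrom-block u v (arrange vs _) (all-filter (hasKey? v) xs))
    (+-monoʳ-≤ (D u v) (pathFrom-arrange v vs _ (covered-tail v cov)))

  path-arrange : ∀ vs xs → (∀ {x} → x ∈ xs → key x ∈ vs) → path D (map key (arrange vs xs)) ≤ path D vs
  path-arrange [] []       cov = z≤n
  path-arrange [] (x ∷ xs) cov with cov (here refl)
  ... | ()
  -- Starting artificially at `v` costs nothing, since the first step of the comparison path goes
  -- from `v` to itself.
  path-arrange (v ∷ vs) xs cov = ≤-trans (path≤pathFrom D v (map key (arrange (v ∷ vs) xs)))
    (≤-trans (pathFrom-arrange v (v ∷ vs) xs cov) (≤-reflexive (cong (_+ pathFrom D v vs) (D-refl v))))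

-- From rearranged lists of rows to permutations, and the bound on the row-Hamming-sum.

↭-allFin-length : {xs : List (Fin n)} → xs ↭ allFin n → n ≡ length xs
↭-allFin-length {n} p = trans (sym (length-tabulate {n = n} id)) (sym (↭-length p))

lookup-allFin : ∀ i → cast (length-tabulate {n = n} id) i ≡ lookup (allFin n) i
lookup-allFin {n} i = trans (sym (lookup-tabulate id _))
  (cong (lookup (allFin n)) (cast-involutive (sym (length-tabulate {n = n} id)) (length-tabulate {n = n} id) i))

↭-allFin⇒permutation : {xs : List (Fin n)} (p : xs ↭ allFin n) →
                       ∃ λ (π : Permutation′ n) → ∀ i → π ⟨$⟩ʳ i ≡ lookup xs (cast (↭-allFin-length p) i)
↭-allFin⇒permutation {n} p =
  cast-id (↭-allFin-length p) ∘ₚ onIndices (↭⇒↭ₛ p) ∘ₚ cast-id (length-tabulate {n = n} id) ,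
  λ i → trans (lookup-allFin _) (sym (onIndices-lookup (setoid (Fin n)) (↭⇒↭ₛ p) _))

hamPath≡path : {Y : Set} (D : Y → Y → ℕ) (key : X → Y) (f : X → Fin c → Bool) →
               (∀ x y → hamming (f x) (f y) ≡ D (key x) (key y)) →
               ∀ xs (g : Fin m → X) (eq : m ≡ length xs) → (∀ i → g i ≡ lookup xs (cast eq i)) →
               hamPath (f ∘ g) ≡ path D (map key xs)
hamPath≡path {m = zero}        D key f iso []           g eq g≡ = refl
hamPath≡path {m = suc zero}    D key f iso (x ∷ [])     g eq g≡ = refl
hamPath≡path {m = suc (suc m)} D key f iso (x ∷ y ∷ xs) g eq g≡ = cong₂ _+_
  (trans (cong₂ (λ s t → hamming (f s) (f t)) (g≡ zero) (g≡ (suc zero))) (iso x y))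
  (hamPath≡path D key f iso (y ∷ xs) (g ∘ suc) (suc-injective eq) (g≡ ∘ suc))

hamming≡sum : (u v : Fin c → Bool) → hamming u v ≡ sum (λ j → diff (u j) (v j))
hamming≡sum {zero}  u v = refl
hamming≡sum {suc c} u v = cong (diff (u zero) (v zero) +_) (hamming≡sum (u ∘ suc) (v ∘ suc))

-- Distances between rows are sums over columns, so the column order `τ` of the merge sequence does
-- not affect them.
hamming-permute : (u v : Fin c → Bool) (τ : Permutation′ c) →
                  hamming u v ≡ hamming (u ∘ (τ ⟨$⟩ʳ_)) (v ∘ (τ ⟨$⟩ʳ_))
hamming-permute u v τ = trans (hamming≡sum u v)
  (trans (sum-permute (λ j → diff (u j) (v j)) τ) (sym (hamming≡sum (u ∘ (τ ⟨$⟩ʳ_)) (v ∘ (τ ⟨$⟩ʳ_)))))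

hamming≡wdist : (u v : Fin c → Bool) → hamming u v ≡ wdist (replicate c 1) (Vec.tabulate u) (Vec.tabulate v)
hamming≡wdist {zero}  u v = refl
hamming≡wdist {suc c} u v = cong₂ _+_ (sym (+-identityʳ _)) (hamming≡wdist (u ∘ suc) (v ∘ suc))

toEntry-choices : ∀ x → x ∈ choices (toEntry x)
toEntry-choices false = here refl
toEntry-choices true  = here refl

short-row-order : (M : BinMat n) → TwinWidth≤ M d →
                  ∃ λ π → rowHammingSum M π ≤ factor d * nlogn n + n
short-row-order {n} {d} M (σ , τ , seq) = π , (begin
  rowHammingSum M π                          ≡⟨ hamPath≡path (wdist ones) row M isometry order _ (↭-allFin-length order↭) π≡ ⟩
  path (wdist ones) (map row order)          ≤⟨ path-arrange (S .vertices) (allFin n) (λ {x} _ → row∈ x) ⟩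
  -- The potential is inserted to match `short`; it is zero for unit weights, as `nlogn 1` is 0.
  path (wdist ones) (S .vertices)            ≤⟨ m≤m+n _ _ ⟩
  path (wdist ones) (S .vertices) + factor d * total nlogn ones
                                             ≤⟨ S .short ⟩
  factor d * nlogn (total id ones) + total id ones
                                             ≡⟨ cong (λ t → factor d * nlogn t + t) (total-replicate n) ⟩
  factor d * nlogn n + n                     ∎)
  where
  open ≤-Reasoning
  ones = replicate n 1
  S = shortPath seq ones
  row : Fin n → Vec Bool n
  row x = Vec.tabulate (λ j → M x (τ ⟨$⟩ʳ j))
  open Arrange (≡-dec _≟ᵇ_) (wdist ones) (wdist-refl ones) (wdist-triangle ones) row
  order = arrange (S .vertices) (allFin n)
  order↭ = arrange-↭ (S .vertices) (allFin n)
  π = proj₁ (↭-allFin⇒permutation order↭)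
  π≡ = proj₂ (↭-allFin⇒permutation order↭)
  isometry : ∀ x y → hamming (M x) (M y) ≡ wdist ones (row x) (row y)
  isometry x y = trans (hamming-permute (M x) (M y) τ) (hamming≡wdist (M x ∘ (τ ⟨$⟩ʳ_)) (M y ∘ (τ ⟨$⟩ʳ_)))
  row∈ : ∀ x → row x ∈ S .vertices
  -- Row `x` of `M` is row `σ ⟨$⟩ˡ x` of the reordered matrix.
  row∈ x = S .covers (σ ⟨$⟩ˡ x) (row x) λ j →
    subst (_∈ choices (toEntry (M (σ ⟨$⟩ʳ (σ ⟨$⟩ˡ x)) (τ ⟨$⟩ʳ j))))
      (trans (cong (λ y → M y (τ ⟨$⟩ʳ j)) (inverseʳ σ)) (sym (lookup∘tabulate _ j)))
      (toEntry-choices _)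

-- Columns by transposition.

mergeSeq-transpose : {A : Mat r c} → MergeSeq d A → MergeSeq d (λ j i → A i j)
mergeSeq-transpose (single A (rows , cols))         = single _ (cols , rows)
mergeSeq-transpose (rowMerge A i (rows , cols) seq) = colMerge _ i (cols , rows) (mergeSeq-transpose seq)
mergeSeq-transpose (colMerge A i (rows , cols) seq) = rowMerge _ i (cols , rows) (mergeSeq-transpose seq)

twinWidth≤-transpose : (M : BinMat n) → TwinWidth≤ M d → TwinWidth≤ (transpose M) d
twinWidth≤-transpose M (σ , τ , seq) = τ , σ , mergeSeq-transpose seq

-- Constants and the final bound.

n<2^n : ∀ n → n < 2 ^ n
n<2^n zero    = s≤s z≤n
n<2^n (suc n) = begin-strict
  suc n           ≤⟨ n<2^n n ⟩
  2 ^ n           <⟨ m<m+n (2 ^ n) (m^n>0 2 n) ⟩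
  2 ^ n + 2 ^ n   ≡⟨ cong (2 ^ n +_) (+-identityʳ (2 ^ n)) ⟨
  2 ^ suc n       ∎
  where open ≤-Reasoning

-- Bounding `suc d` by `2 ^ d` gives the single exponential `2 ^ suc (d + d)`, whose exponent lies
-- below `2 * (d + 1)` and hence below `2 ^ (2 * (d + 1))`. This is the source of the constant 2.
factor<2^2^ : ∀ d → factor d + 1 ≤ 2 ^ (2 ^ (2 * (d + 1)))
factor<2^2^ d = begin
  d * 2 ^ d * 2 + 1                   ≤⟨ +-monoʳ-≤ _ (≤-trans (m^n>0 2 d) (m≤m*n (2 ^ d) 2)) ⟩
  d * 2 ^ d * 2 + 2 ^ d * 2           ≡⟨ rearrange d (2 ^ d) ⟩
  suc d * 2 ^ d * 2                   ≤⟨ *-monoˡ-≤ 2 (*-monoˡ-≤ (2 ^ d) (n<2^n d)) ⟩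
  2 ^ d * 2 ^ d * 2                   ≡⟨ cong (_* 2) (^-distribˡ-+-* 2 d d) ⟨
  2 ^ (d + d) * 2                     ≡⟨ *-comm (2 ^ (d + d)) 2 ⟩
  2 ^ suc (d + d)                     ≤⟨ ^-monoʳ-≤ 2 (≤-trans (m≤n+m _ 1) (≤-trans (≤-reflexive (exponent d)) (<⇒≤ (n<2^n _)))) ⟩
  2 ^ (2 ^ (2 * (d + 1)))             ∎
  where
  open ≤-Reasoning
  rearrange : ∀ d p → d * p * 2 + p * 2 ≡ suc d * p * 2
  rearrange = solve-∀
  exponent : ∀ d → 1 + suc (d + d) ≡ 2 * (d + 1)
  exponent = solve-∀

coherence-bound : (M : BinMat n) → 2 ≤ n → TwinWidth≤ M d → ∀ h → IsRowHammingCoherence M h →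
                  h ≤ 2 ^ (2 ^ (2 * (d + 1))) * n * ⌊log₂ n ⌋
coherence-bound {n} {d} M 2≤n tw h (_ , minimal) with short-row-order M tw
... | π , le = begin
  h                                           ≤⟨ minimal π ⟩
  rowHammingSum M π                           ≤⟨ le ⟩
  factor d * nlogn n + n                      ≡⟨ cong (factor d * nlogn n +_) (*-identityʳ n) ⟨
  -- For `n` at least 2 the logarithm is at least 1, so the additive `n` is absorbed into one more
  -- `nlogn n`.
  factor d * nlogn n + n * 1                  ≤⟨ +-monoʳ-≤ _ (*-monoʳ-≤ n (⌊log₂⌋-mono-≤ 2≤n)) ⟩
  factor d * nlogn n + nlogn n                ≡⟨ rearrange (factor d) n ⌊log₂ n ⌋ ⟩
  (factor d + 1) * n * ⌊log₂ n ⌋              ≤⟨ *-monoˡ-≤ ⌊log₂ n ⌋ (*-monoˡ-≤ n (factor<2^2^ d)) ⟩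
  2 ^ (2 ^ (2 * (d + 1))) * n * ⌊log₂ n ⌋     ∎
  where
  open ≤-Reasoning
  rearrange : ∀ f n l → f * (n * l) + n * l ≡ (f + 1) * n * l
  rearrange = solve-∀

theorem3 : Σ ℕ λ C → 0 < C ×
    (∀ (n : ℕ) → 2 ≤ n → (M : BinMat n) (d : ℕ) → HasTwinWidth M d →
    (∀ h → IsRowHammingCoherence M h → h ≤ 2 ^ (2 ^ (C * (d + 1))) * n * ⌊log₂ n ⌋) ×
    (∀ h → IsColHammingCoherence M h → h ≤ 2 ^ (2 ^ (C * (d + 1))) * n * ⌊log₂ n ⌋))
theorem3 = 2 , s≤s z≤n , λ n 2≤n M d (tw , _) →
  coherence-bound M 2≤n tw , coherence-bound (transpose M) 2≤n (twinWidth≤-transpose M tw)
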